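{- Among all finite, connected, simple $3$-regular $4$-ordered hamiltonian graphs other than $K_4$ and $K_{3,3}$, the Heawood graph has the fewest vertices. That is, every finite connected simple $3$-regular $4$-ordered hamiltonian graph not isomorphic to $K_4$ or $K_{3,3}$ has at least $14$ vertices, and the Heawood graph (which has $14$ vertices) is $3$-regular and $4$-ordered hamiltonian.
   Context: A simple graph $G$ is called $k$-ordered hamiltonian if for every sequence $v_1,\ldots,v_k$ of $k$ distinct vertices of $G$ there exists a hamiltonian cycle in $G$ containing these $k$ vertices in the specified (cyclic) order. The Heawood graph is the $3$-regular bipartite graph on $14$ vertices given by the point–line incidence graph of the Fano plane; equivalently, it is the graph with vertices $0,1,\ldots,13$ forming a hamiltonian cycle $0-1-2-\cdots-13-0$, together with the chords joining $i$ and $i+5 \pmod{14}$ for every even $i$. -}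

module Defs where

open import Data.Bool.Base using (Bool; true; false)
open import Data.Bool.Properties using () renaming (_≟_ to _≟ᵇ_)
open import Data.Fin.Base using (Fin; toℕ; splitAt; _<_)
open import Data.Fin.Properties using (_≟_; all?)
open import Data.List.Base using (length; filter; allFin)
open import Data.Nat.Base using (ℕ; suc; _+_; _≤_; NonZero)
open import Data.Nat.DivMod using (_mod_)
open import Data.Nat.Divisibility using (_∣_; _∣?_)
open import Data.Product.Base using (Σ-syntax; ∃-syntax; _×_)
open import Data.Sum.Base using (_⊎_; [_,_]′; swap)
open import Function.Base using (const)
open import Function.Bundles using (_↔_; _⇔_; Inverse)
open import Function.Definitions using (Injective; Bijective)
open import Level using (0ℓ)
open import Relation.Binary.Construct.Closure.ReflexiveTransitive using (Star)
open import Relation.Binary.Core using (Rel)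
open import Relation.Binary.Definitions using (Symmetric; Irreflexive; Decidable)
open import Relation.Binary.PropositionalEquality.Core using (_≡_; _≢_; refl; ≢-sym)
open import Relation.Nullary.Decidable using (¬?; _×-dec_; _⊎-dec_; from-yes)
open import Relation.Nullary.Negation.Core using (¬_)

record Graph : Set₁ where
  infix 4 _~_ _~?_
  field
    order  : ℕ
    _~_    : Rel (Fin order) 0ℓ
    _~?_   : Decidable _~_
    ~-sym  : Symmetric _~_
    ~-irr  : Irreflexive _≡_ _~_

  Vertex : Set
  Vertex = Fin order

  degree : Vertex → ℕ
  degree v = length (filter (v ~?_) (allFin order))

open Graph using (order; Vertex; degree)

Regular : ℕ → Graph → Set
Regular d G = ∀ v → degree G v ≡ d

-- The empty graph is not connected.  It would otherwise be connected,
-- regular of every degree, and k-ordered hamiltonian for every k ≥ 1.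
Connected : Graph → Set
Connected G = NonZero (order G) × (∀ u v → Star (Graph._~_ G) u v)

infix 4 _≅_

_≅_ : Graph → Graph → Set
G ≅ H = Σ[ f ∈ Vertex G ↔ Vertex H ]
          (∀ u v → Graph._~_ G u v ⇔ Graph._~_ H (Inverse.to f u) (Inverse.to f v))

-- Successor modulo n: the last element is sent to zero.
next : ∀ {n} → Fin n → Fin n
next {suc m} i = suc (toℕ i) mod suc m

-- A hamiltonian cycle presented by traversing it once, from any starting
-- vertex and in either direction.
record HamiltonianCycle (G : Graph) : Set where
  open Graph G using (_~_)
  field
    length≥3  : 3 ≤ order G
    at        : Fin (order G) → Vertex G
    bijective : Bijective _≡_ _≡_ at
    adjacent  : ∀ i → at i ~ at (next i)

Encounters : ∀ {G k} → HamiltonianCycle G → (Fin k → Vertex G) → Set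
Encounters {G} {k} C v =
  Σ[ p ∈ (Fin k → Fin (order G)) ]
    (∀ i → HamiltonianCycle.at C (p i) ≡ v i) × (∀ {i j} → i < j → p i < p j)

-- The order is cyclic because the traversal of the cycle, including its
-- starting vertex and direction, is existentially quantified.
OrderedHamiltonian : ℕ → Graph → Set
OrderedHamiltonian k G =
  (v : Fin k → Vertex G) → Injective _≡_ _≡_ v →
  ∃[ C ] Encounters {G} C v

K : ℕ → Graph
K n = record
  { order = n
  ; _~_   = _≢_
  ; _~?_  = λ u v → ¬? (u ≟ v)
  ; ~-sym = ≢-sym
  ; ~-irr = λ u≡v u≢v → u≢v u≡v
  }

K[_,_] : ℕ → ℕ → Graph
K[ m , n ] = record
  { order = m + n
  ; _~_   = λ u v → inLeft u ≢ inLeft v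
  ; _~?_  = λ u v → ¬? (inLeft u ≟ᵇ inLeft v)
  ; ~-sym = ≢-sym
  ; ~-irr = λ { refl u≢u → u≢u refl }
  }
  where
  inLeft : Fin (m + n) → Bool
  inLeft u = [ const true , const false ]′ (splitAt m u)

module HeawoodEdges where
  _⟶_ : Rel (Fin 14) 0ℓ
  i ⟶ j = j ≡ next i ⊎ (2 ∣ toℕ i × j ≡ (toℕ i + 5) mod 14)

  _⟶?_ : Decidable _⟶_
  i ⟶? j = (j ≟ next i) ⊎-dec ((2 ∣? toℕ i) ×-dec (j ≟ (toℕ i + 5) mod 14))

  ⟶-irr : ∀ i → ¬ (i ⟶ i)
  ⟶-irr = from-yes (all? λ i → ¬? (i ⟶? i))

Heawood : Graph
Heawood = record
  { order = 14
  ; _~_   = λ i j → i ⟶ j ⊎ j ⟶ i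
  ; _~?_  = λ i j → (i ⟶? j) ⊎-dec (j ⟶? i)
  ; ~-sym = swap
  ; ~-irr = λ { {i} refl → [ ⟶-irr i , ⟶-irr i ]′ }
  }
  where open HeawoodEdges

{-# OPTIONS --safe #-}

-- A hamiltonian cycle meeting a, x, b, y in this order uses neither an edge a − b nor an edge
-- x − y.  With every vertex using two of its three edges, this excludes triangles a b c (meet
-- a, d, b, e with d, e outside) and forces two vertices with two common neighbours to have the
-- same neighbourhood, so that a square lies in a component K₃,₃.  A graph of order at least 7 is
-- therefore a cycle plus a matching of chords without triangles and squares.  For orders below 14
-- such matchings exist only for order 12, and a search shows that for each of them one of three
-- fixed vertex sequences is met in order by no hamiltonian cycle.
--
-- In the Heawood graph an automorphism moves the last of the four vertices to 0, and the
-- hamiltonian cycles traversed so as to end at 0 meet the other 13 vertices in every order of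
-- three.

module Submission where

open import Defs
open import Data.Empty using (⊥; ⊥-elim)
open import Data.Fin.Base as Fin using (Fin; zero; suc; toℕ; fromℕ<; inject₁)
open import Data.Fin.Induction using (<-weakInduction)
open import Data.Fin.Patterns using (0F; 1F; 2F; 3F; 4F; 5F; 6F)
open import Data.Fin.Permutation using (↔⇒≡)
open import Data.Fin.Properties as Fin
  using (_≟_; _<?_; all?; toℕ-fromℕ<; toℕ-injective; toℕ<n; injective⇒≤; ¬∀⟶∃¬)
open import Data.List.Base as List using (List; []; _∷_; allFin; concatMap; drop; filter; length)
open import Data.List.Membership.Propositional using (_∈_; _∉_)
import Data.List.Membership.DecPropositional as DecMembership
open import Data.List.Membership.Propositional.Properties using (∈-filter⁺; ∈-filter⁻; ∈-allFin; ∈-++⁺ˡ; ∈-++⁺ʳ)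
open import Data.List.Membership.Setoid.Properties using (index-injective)
open import Data.List.Relation.Unary.All as All using (All; []; _∷_)
open import Data.List.Relation.Unary.AllPairs using ([]; _∷_)
open import Data.List.Relation.Unary.Any as Any using (Any; here; there)
import Data.List.Relation.Unary.Unique.Propositional as ListUnique
open import Data.List.Relation.Unary.Unique.Propositional.Properties using (filter⁺; allFin⁺)
open import Data.Nat.Base as ℕ using (ℕ; zero; suc; _+_; _∸_; _%_; _≤_; _<_; z≤n; s≤s; z<s; s<s; NonZero)
open import Data.Nat.Divisibility using (_∣?_)
open import Data.Nat.DivMod using (m%n<n; m<n⇒m%n≡m; [m+n]%n≡m%n; %-distribˡ-+; m%n%n≡m%n; _mod_)
open import Data.Nat.Properties as ℕ hiding (_≟_; _<?_; _≤?_)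
open import Data.Product.Base using (_×_; _,_; proj₁; proj₂; ∃-syntax; Σ-syntax)
open import Data.Sum.Base using (_⊎_; inj₁; inj₂; [_,_]′)
open import Data.Unit.Base using (⊤; tt)
open import Data.Vec.Base as Vec using (Vec; []; _∷_; lookup; tabulate; head)
open import Data.Vec.Relation.Unary.All using ([]; _∷_)
open import Data.Vec.Relation.Unary.AllPairs using ([]; _∷_; allPairs?)
import Data.Vec.Relation.Unary.Any as VecAny
open import Data.Vec.Relation.Unary.Unique.Propositional using (Unique)
open import Data.Vec.Relation.Unary.Unique.Propositional.Properties using (lookup-injective; map⁺)
open import Function.Base using (_∘_; id)
open import Function.Bundles using (_↔_; _⇔_; mk↔ₛ′; mk⇔; Inverse; Equivalence)
open import Function.Construct.Identity using (↔-id)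
open import Level using (0ℓ)
open import Relation.Binary.Construct.Closure.ReflexiveTransitive as Star using (Star; ε; _◅_; _◅◅_)
open import Relation.Binary.Core using (Rel)
open import Relation.Binary.Definitions using (tri<; tri≈; tri>)
open import Relation.Binary.PropositionalEquality
open import Relation.Nullary
open import Relation.Nullary.Decidable using (from-yes; ¬?; _×-dec_; _→-dec_)
open import Relation.Unary using (Decidable)

-- Cyclic shifts

shift : ∀ {n} → ℕ → Fin n → Fin n
shift {suc m} k i = (toℕ i + k) mod suc m

private
  toℕ-mod : ∀ m n .{{_ : NonZero n}} → toℕ (m mod n) ≡ m % n
  toℕ-mod m n = toℕ-fromℕ< (m%n<n m n)

  %-remainderˡ : ∀ m k n .{{_ : NonZero n}} → (m % n + k) % n ≡ (m + k) % n
  %-remainderˡ m k n = begin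
    (m % n + k) % n              ≡⟨ %-distribˡ-+ (m % n) k n ⟩
    (m % n % n + k % n) % n      ≡⟨ cong (λ x → (x + k % n) % n) (m%n%n≡m%n m n) ⟩
    (m % n + k % n) % n          ≡⟨ %-distribˡ-+ m k n ⟨
    (m + k) % n                  ∎
    where open ≡-Reasoning

toℕ-shift : ∀ {m} k (i : Fin (suc m)) → toℕ (shift k i) ≡ (toℕ i + k) % suc m
toℕ-shift {m} k i = toℕ-mod (toℕ i + k) (suc m)

shift-+ : ∀ {n} j k (i : Fin n) → shift j (shift k i) ≡ shift (k + j) i
shift-+ {suc m} j k i = toℕ-injective (begin
  toℕ (shift j (shift k i))               ≡⟨ toℕ-shift j (shift k i) ⟩
  (toℕ (shift k i) + j) % suc m           ≡⟨ cong (λ x → (x + j) % suc m) (toℕ-shift k i) ⟩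
  ((toℕ i + k) % suc m + j) % suc m       ≡⟨ %-remainderˡ (toℕ i + k) j (suc m) ⟩
  (toℕ i + k + j) % suc m                 ≡⟨ cong (_% suc m) (+-assoc (toℕ i) k j) ⟩
  (toℕ i + (k + j)) % suc m               ≡⟨ toℕ-shift (k + j) i ⟨
  toℕ (shift (k + j) i)                   ∎)
  where open ≡-Reasoning

shift-toℕ : ∀ {n} k {i j : Fin n} → toℕ i + k ≡ toℕ j → shift k i ≡ j
shift-toℕ {suc m} k {i} {j} eq = toℕ-injective (begin
  toℕ (shift k i)         ≡⟨ toℕ-shift k i ⟩
  (toℕ i + k) % suc m     ≡⟨ cong (_% suc m) eq ⟩
  toℕ j % suc m           ≡⟨ m<n⇒m%n≡m (toℕ<n j) ⟩
  toℕ j                   ∎)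
  where open ≡-Reasoning

shift-0 : ∀ {n} (i : Fin n) → shift 0 i ≡ i
shift-0 i = shift-toℕ 0 (+-identityʳ (toℕ i))

shift-order : ∀ {n} (i : Fin n) → shift n i ≡ i
shift-order {suc m} i = toℕ-injective (begin
  toℕ (shift (suc m) i)       ≡⟨ toℕ-shift (suc m) i ⟩
  (toℕ i + suc m) % suc m     ≡⟨ [m+n]%n≡m%n (toℕ i) (suc m) ⟩
  toℕ i % suc m               ≡⟨ m<n⇒m%n≡m (toℕ<n i) ⟩
  toℕ i                       ∎)
  where open ≡-Reasoning

next≡shift : ∀ {n} (i : Fin n) → next i ≡ shift 1 i
next≡shift {suc m} i = cong (_mod suc m) (+-comm 1 (toℕ i))

next-shift : ∀ {n} k (i : Fin n) → next (shift k i) ≡ shift (suc k) i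
next-shift k i = begin
  next (shift k i)      ≡⟨ next≡shift (shift k i) ⟩
  shift 1 (shift k i)   ≡⟨ shift-+ 1 k i ⟩
  shift (k + 1) i       ≡⟨ cong (λ x → shift x i) (+-comm k 1) ⟩
  shift (suc k) i       ∎
  where open ≡-Reasoning

-- The residue of `j − i` modulo `n`; adding `n ∸ toℕ i` in place of subtracting `toℕ i` avoids
-- truncation.
distance : ∀ {n} → Fin n → Fin n → ℕ
distance {n} i j = toℕ (shift (n ∸ toℕ i) j)

shift-distance : ∀ {n} (i j : Fin n) → shift (distance i j) i ≡ j
shift-distance {suc m} i j = toℕ-injective (begin
  toℕ (shift d i)                                   ≡⟨ toℕ-shift d i ⟩
  (toℕ i + d) % suc m                               ≡⟨ cong (_% suc m) (+-comm (toℕ i) d) ⟩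
  (d + toℕ i) % suc m                               ≡⟨ toℕ-shift (toℕ i) (shift (suc m ∸ toℕ i) j) ⟨
  toℕ (shift (toℕ i) (shift (suc m ∸ toℕ i) j))     ≡⟨ cong toℕ (shift-+ (toℕ i) (suc m ∸ toℕ i) j) ⟩
  toℕ (shift (suc m ∸ toℕ i + toℕ i) j)             ≡⟨ cong (λ x → toℕ (shift x j)) (m∸n+n≡m (<⇒≤ (toℕ<n i))) ⟩
  toℕ (shift (suc m) j)                             ≡⟨ cong toℕ (shift-order j) ⟩
  toℕ j                                             ∎)
  where
  open ≡-Reasoning
  d = distance i j

distance-shift : ∀ {n k} (i : Fin n) → k < n → distance i (shift k i) ≡ k
distance-shift {suc m} {k} i k<n = begin
  toℕ (shift (suc m ∸ toℕ i) (shift k i))      ≡⟨ cong toℕ (shift-+ (suc m ∸ toℕ i) k i) ⟩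
  toℕ (shift (k + (suc m ∸ toℕ i)) i)          ≡⟨ toℕ-shift (k + (suc m ∸ toℕ i)) i ⟩
  (toℕ i + (k + (suc m ∸ toℕ i))) % suc m      ≡⟨ cong (_% suc m) (+-comm (toℕ i) _) ⟩
  (k + (suc m ∸ toℕ i) + toℕ i) % suc m        ≡⟨ cong (_% suc m) (+-assoc k _ (toℕ i)) ⟩
  (k + (suc m ∸ toℕ i + toℕ i)) % suc m        ≡⟨ cong (λ x → (k + x) % suc m) (m∸n+n≡m (<⇒≤ (toℕ<n i))) ⟩
  (k + suc m) % suc m                          ≡⟨ [m+n]%n≡m%n k (suc m) ⟩
  k % suc m                                    ≡⟨ m<n⇒m%n≡m k<n ⟩
  k                                            ∎
  where open ≡-Reasoning

shift-injective : ∀ {n j k} (i : Fin n) → j < n → k < n → shift j i ≡ shift k i → j ≡ k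
shift-injective i j<n k<n eq =
  trans (sym (distance-shift i j<n)) (trans (cong (distance i) eq) (distance-shift i k<n))

prev : ∀ {n} → Fin n → Fin n
prev {n} = shift (n ∸ 1)

prev-next : ∀ {n} (i : Fin n) → prev (next i) ≡ i
prev-next {suc m} i = trans (cong prev (next≡shift i)) (trans (shift-+ m 1 i) (shift-order i))

next-prev : ∀ {n} (i : Fin n) → next (prev i) ≡ i
next-prev {suc m} i = trans (next-shift m i) (shift-order i)

next²≢ : ∀ {n} → 3 ≤ n → (i : Fin n) → next (next i) ≢ i
next²≢ 3≤n i eq with () ← shift-injective {j = 2} {0} i 3≤n (<-trans (s≤s z≤n) 3≤n)
  (trans (sym (trans (cong next (next≡shift i)) (next-shift 1 i))) (trans eq (sym (shift-0 i))))

-- Otherwise sending each vertex to its index in `xs` would inject `Fin n` into `Fin (length xs)`.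
fresh : ∀ {n} (xs : List (Fin n)) → length xs < n → ∃[ v ] v ∉ xs
fresh {n} xs ∣xs∣<n = ¬∀⟶∃¬ n (_∈ xs) (λ v → Any.any? (v ≟_) xs) λ all∈ →
  <⇒≱ ∣xs∣<n (injective⇒≤ (index-injective (setoid _) (all∈ _) (all∈ _)))

-- Tours through four vertices

record Tour {n} (_~_ : Rel (Fin n) 0ℓ) (v₀ v₁ v₂ v₃ : Fin n) : Set where
  field
    -- Positions are natural numbers counted from `v₀`: the closing edge becomes the ordinary step
    -- from `n − 1` to `n`, and the cyclic order becomes a chain of inequalities.
    walk      : ℕ → Fin n
    step      : ∀ k → walk k ~ walk (suc k)
    closed    : walk n ≡ walk 0
    injective : ∀ {j k} → j < n → k < n → walk j ≡ walk k → j ≡ k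
    visits    : ∀ v → ∃[ k ] k < n × walk k ≡ v
    {k₁ k₂ k₃} : ℕ
    0<k₁      : 0 < k₁
    k₁<k₂     : k₁ < k₂
    k₂<k₃     : k₂ < k₃
    k₃<n      : k₃ < n
    at₀       : walk 0 ≡ v₀
    at₁       : walk k₁ ≡ v₁
    at₂       : walk k₂ ≡ v₂
    at₃       : walk k₃ ≡ v₃

  k₂<n : k₂ < n
  k₂<n = <-trans k₂<k₃ k₃<n

  k₁<n : k₁ < n
  k₁<n = <-trans k₁<k₂ k₂<n

  0<n : 0 < n
  0<n = <-trans 0<k₁ k₁<n

  2<n : 2 < n
  2<n = ≤-<-trans (≤-<-trans 0<k₁ k₁<k₂) (<-trans k₂<k₃ k₃<n)

TourThrough : ∀ {n} → Rel (Fin n) 0ℓ → Vec (Fin n) 4 → Set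
TourThrough _~_ s = Tour _~_ (lookup s 0F) (lookup s 1F) (lookup s 2F) (lookup s 3F)

-- Applied along the labelling of a graph by its hamiltonian cycle and, with identity maps, to
-- exchange pointwise equal matchings.
relabel : ∀ {n} {_~_ _≈_ : Rel (Fin n) 0ℓ} (f g : Fin n → Fin n) → (∀ i → g (f i) ≡ i) → (∀ j → f (g j) ≡ j) →
  (∀ {i j} → i ~ j → f i ≈ f j) → ∀ {v₀ v₁ v₂ v₃} → Tour _~_ (g v₀) (g v₁) (g v₂) (g v₃) → Tour _≈_ v₀ v₁ v₂ v₃
relabel f g gf fg preserves T = record
  { walk = f ∘ walk
  ; step = preserves ∘ step
  ; closed = cong f closed
  ; injective = λ j<n k<n eq → injective j<n k<n (trans (sym (gf _)) (trans (cong g eq) (gf _)))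
  ; visits = λ v → let (k , k<n , eq) = visits (g v) in k , k<n , trans (cong f eq) (fg v)
  ; 0<k₁ = 0<k₁ ; k₁<k₂ = k₁<k₂ ; k₂<k₃ = k₂<k₃ ; k₃<n = k₃<n
  ; at₀ = reaches at₀ ; at₁ = reaches at₁ ; at₂ = reaches at₂ ; at₃ = reaches at₃
  }
  where
  open Tour T
  reaches : ∀ {k v} → walk k ≡ g v → f (walk k) ≡ v
  reaches eq = trans (cong f eq) (fg _)

-- Chord matchings of a cycle

module _ {n : ℕ} where
  open DecMembership (_≟_ {n}) using (_∈?_)

  -- The cycle 0 − 1 − ⋯ − (n−1) − 0 together with the chords i − m i.
  Linked : (Fin n → Fin n) → Rel (Fin n) 0ℓ
  Linked m i j = j ∈ next i ∷ prev i ∷ m i ∷ []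

  advance : Fin n → List (Fin n) → List (Fin n)
  advance x []       = []
  advance x (t ∷ ts) with x ≟ t
  ... | yes _ = ts
  ... | no  _ = t ∷ ts

  -- A path from s to i through the vertices in visited cannot be completed,
  -- by r further vertices, to a hamiltonian cycle meeting the targets in order.
  Stuck : (Fin n → Fin n) → Fin n → ℕ → (visited : List (Fin n)) → Fin n → (targets : List (Fin n)) → Set
  Stuck m s zero    visited i targets = ¬ Linked m i s
  Stuck m s (suc r) visited i targets =
    All (λ j → j ∉ visited → j ∉ drop 1 targets → Stuck m s r (j ∷ visited) j (advance j targets))
      (next i ∷ prev i ∷ m i ∷ [])

  stuck? : ∀ m s r visited i targets → Dec (Stuck m s r visited i targets)
  stuck? m s zero    visited i targets = ¬? (s ∈? _)
  stuck? m s (suc r) visited i targets = All.all?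
    (λ j → ¬? (j ∈? visited) →-dec ¬? (j ∈? drop 1 targets) →-dec
      stuck? m s r (j ∷ visited) j (advance j targets)) _

  module _ {m s v₁ v₂ v₃} (T : Tour (Linked m) s v₁ v₂ v₃) where
    open Tour T

    Ahead : ℕ → List (Fin n) → Set
    Ahead k []       = ⊤
    Ahead k (t ∷ ts) = ∃[ p ] k < p × p < n × walk p ≡ t × Ahead p ts

    ahead-all : ∀ {k} ts → Ahead k ts → All (λ t → ∃[ p ] k < p × p < n × walk p ≡ t) ts
    ahead-all []       _                            = []
    ahead-all (t ∷ ts) (p , k<p , p<n , eq , ahead) = (p , k<p , p<n , eq) ∷
      All.map (λ { (q , p<q , rest) → q , <-trans k<p p<q , rest }) (ahead-all ts ahead)

    -- Why the search may discard a branch that meets a later target early: the position of that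
    -- target exceeds `p`, which is at least `suc k`, and below `n` the walk repeats no vertex.
    ahead-∉ : ∀ {k} ts → suc k < n → Ahead k ts → walk (suc k) ∉ drop 1 ts
    ahead-∉ (t ∷ ts) 1+k<n (p , k<p , p<n , _ , ahead) t∈ts with All.lookup (ahead-all ts ahead) t∈ts
    ... | q , p<q , q<n , eq = contradiction (injective q<n 1+k<n eq) (>⇒≢ (≤-<-trans k<p p<q))

    ahead-advance : ∀ {k} ts → suc k < n → Ahead k ts → Ahead (suc k) (advance (walk (suc k)) ts)
    ahead-advance []       _ _ = tt
    ahead-advance {k} (t ∷ ts) 1+k<n (p , k<p , p<n , eq , ahead) with walk (suc k) ≟ t
    ... | yes eq′ with refl ← injective p<n 1+k<n (trans eq (sym eq′)) = ahead
    ... | no  neq = p , ≤∧≢⇒< k<p (λ { refl → neq eq }) , p<n , eq , ahead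

    -- The tour is itself a branch of the search: each of its steps passes both tests, and its
    -- closing edge contradicts the bottom case. The number `r` counts the vertices still to come.
    ¬stuck : ∀ r k {visited} ts → suc k + r ≡ n → All (λ v → ∃[ j ] j ≤ k × walk j ≡ v) visited →
      Ahead k ts → ¬ Stuck m s r visited (walk k) ts
    ¬stuck zero k ts eq _ _ stuck = stuck (subst (Linked m (walk k)) eq′ (step k))
      where eq′ = trans (cong walk (trans (sym (+-identityʳ (suc k))) eq)) (trans closed at₀)
    ¬stuck (suc r) k {visited} ts eq past ahead stuck =
      ¬stuck r (suc k) (advance (walk (suc k)) ts) eq′
        ((suc k , ≤-refl , refl) ∷ All.map (λ { (j , j≤k , at-j) → j , m≤n⇒m≤1+n j≤k , at-j }) past)
        (ahead-advance ts 1+k<n ahead)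
        (All.lookup stuck (step k) notVisited (ahead-∉ ts 1+k<n ahead))
      where
      eq′ : suc (suc k) + r ≡ n
      eq′ = trans (sym (+-suc (suc k) r)) eq
      1+k<n : suc k < n
      1+k<n = subst (suc k <_) eq′ (m≤m+n (suc (suc k)) r)
      notVisited : walk (suc k) ∉ visited
      notVisited v∈ with All.lookup past v∈
      ... | j , j≤k , at-j =
        contradiction (injective (≤-<-trans j≤k (<-trans (n<1+n k) 1+k<n)) 1+k<n at-j) (<⇒≢ (s≤s j≤k))

  Obstructed : (Fin n → Fin n) → Vec (Fin n) 4 → Set
  Obstructed m (a ∷ b ∷ c ∷ d ∷ []) = Stuck m a (ℕ.pred n) (a ∷ []) a (b ∷ c ∷ d ∷ [])

  obstructed? : ∀ m → Decidable (Obstructed m)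
  obstructed? m (a ∷ b ∷ c ∷ d ∷ []) = stuck? m a (ℕ.pred n) (a ∷ []) a (b ∷ c ∷ d ∷ [])

  ¬obstructed : ∀ {m} s → TourThrough (Linked m) s → ¬ Obstructed m s
  ¬obstructed {m} (a ∷ b ∷ c ∷ d ∷ []) T stuck = ¬stuck T (ℕ.pred n) 0 (b ∷ c ∷ d ∷ [])
    (suc-pred n {{ℕ.>-nonZero 0<n}}) ((0 , z≤n , at₀) ∷ [])
    (k₁ , 0<k₁ , k₁<n , at₁ , k₂ , k₁<k₂ , k₂<n , at₂ , k₃ , k₂<k₃ , k₃<n , at₃ , tt)
    (subst (λ i → Stuck m a (ℕ.pred n) (a ∷ []) i (b ∷ c ∷ d ∷ [])) (sym at₀) stuck)
    where open Tour T

  -- Search for chord matchings without triangles and squares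

  Pair : Set
  Pair = Fin n × Fin n

  Matched : List Pair → Fin n → Set
  Matched done i = Any (λ p → proj₁ p ≡ i) done

  matched? : ∀ done → Decidable (Matched done)
  matched? done i = Any.any? (λ p → proj₁ p ≟ i) done

  -- Otherwise the chord i − v would close a triangle with edges of the cycle.
  Spread : Fin n → Fin n → Set
  Spread i v = v ≢ i × v ≢ next i × v ≢ next (next i)

  spread? : ∀ i v → Dec (Spread i v)
  spread? i v = ¬? (v ≟ i) ×-dec ¬? (v ≟ next i) ×-dec ¬? (v ≟ next (next i))

  -- Otherwise it would close a triangle or a square.
  Remote : Fin n → Fin n → Set
  Remote i v = Spread i v × v ≢ next (next (next i))

  remote? : ∀ i v → Dec (Remote i v)
  remote? i v = spread? i v ×-dec ¬? (v ≟ next (next (next i)))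

  -- Otherwise the chords i − v and j − w would lie on a square.
  Skew : Pair → Pair → Set
  Skew (i , v) (j , w) = next i ≡ j → next v ≢ w × next w ≢ v

  skew? : ∀ p q → Dec (Skew p q)
  skew? (i , v) (j , w) = next i ≟ j →-dec (¬? (next v ≟ w) ×-dec ¬? (next w ≟ v))

  -- The field `remote` speaks of `next` alone; its counterpart for `prev` is the same condition at
  -- the other end of the chord, by `involutive`.
  record SparseMatching (m : Fin n → Fin n) : Set where
    field
      involutive : ∀ i → m (m i) ≡ i
      remote     : ∀ i → Remote i (m i)
      skew       : ∀ i j → Skew (i , m i) (j , m j)

  Admissible : (done : List Pair) → Pair → Set
  Admissible done p@(i , v) =
    ¬ Matched done v × Remote i v × Remote v i × All (λ q → Skew p q × Skew q p) done

  admissible? : ∀ done → Decidable (Admissible done)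
  admissible? done p@(i , v) =
    ¬? (matched? done v) ×-dec remote? i v ×-dec remote? v i ×-dec All.all? (λ q → skew? p q ×-dec skew? q p) done

  assoc : List Pair → Fin n → Fin n
  assoc []               i = i
  assoc ((j , w) ∷ done) i with j ≟ i
  ... | yes _ = w
  ... | no  _ = assoc done i

  module _ (Leaf : List Pair → Set) where

    -- done lists every chord in both directions.
    EveryMatching : (todo : List (Fin n)) (done : List Pair) → Set
    EveryMatching []         done = Leaf done
    EveryMatching (i ∷ todo) done =
      (Matched done i → EveryMatching todo done) ×
      (¬ Matched done i → All (λ v → Admissible done (i , v) →
        EveryMatching todo ((i , v) ∷ (v , i) ∷ done)) todo)

    everyMatching? : Decidable Leaf → ∀ todo done → Dec (EveryMatching todo done)
    everyMatching? leaf? []         done = leaf? done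
    everyMatching? leaf? (i ∷ todo) done =
      (matched? done i →-dec everyMatching? leaf? todo done) ×-dec
      (¬? (matched? done i) →-dec All.all? (λ v → admissible? done (i , v) →-dec
        everyMatching? leaf? todo ((i , v) ∷ (v , i) ∷ done)) todo)

    module _ {m : Fin n → Fin n} (sparse : SparseMatching m) where
      open SparseMatching sparse

      Consistent : List Pair → Set
      Consistent = All (λ p → proj₂ p ≡ m (proj₁ p))

      assoc-consistent : ∀ {done i} → Consistent done → Matched done i → assoc done i ≡ m i
      assoc-consistent {(j , w) ∷ done} {i} (eq ∷ eqs) matched with j ≟ i
      ... | yes refl = eq
      assoc-consistent (eq ∷ eqs) (here j≡i)      | no j≢i = contradiction j≡i j≢i
      assoc-consistent (eq ∷ eqs) (there matched) | no j≢i = assoc-consistent eqs matched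

      admissible : ∀ {done} i → Consistent done → ¬ Matched done (m i) → Admissible done (i , m i)
      admissible i consistent unmatched = unmatched , remote i ,
        subst (Remote (m i)) (involutive i) (remote (m i)) ,
        All.map (λ { {j , w} refl → skew i j , skew j i }) consistent

      matching-leaf : ∀ todo {done} → Consistent done → (∀ {j} → Matched done j → Matched done (m j)) →
        (∀ j → j ∈ todo ⊎ Matched done j) → EveryMatching todo done →
        ∃[ done ] (∀ j → assoc done j ≡ m j) × Leaf done
      matching-leaf [] {done} consistent _ covered leaf =
        done , (λ j → assoc-consistent consistent ([ (λ ()) , id ]′ (covered j))) , leaf
      matching-leaf (i ∷ todo) {done} consistent symmetric covered (old , new) with matched? done i
      ... | yes matched = matching-leaf todo consistent symmetric covered′ (old matched)
        where
        covered′ : ∀ j → j ∈ todo ⊎ Matched done j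
        covered′ j with covered j
        ... | inj₁ (here refl) = inj₂ matched
        ... | inj₁ (there j∈)  = inj₁ j∈
        ... | inj₂ matched-j   = inj₂ matched-j
      ... | no unmatched = matching-leaf todo (refl ∷ sym (involutive i) ∷ consistent) symmetric′ covered′
              (All.lookup (new unmatched) mi∈todo (admissible i consistent unmatched′))
        where
        unmatched′ : ¬ Matched done (m i)
        unmatched′ matched = unmatched (subst (Matched done) (involutive i) (symmetric matched))
        mi∈todo : m i ∈ todo
        mi∈todo with covered (m i)
        ... | inj₁ (here mi≡i) = contradiction mi≡i (proj₁ (proj₁ (remote i)))
        ... | inj₁ (there mi∈) = mi∈
        ... | inj₂ matched     = contradiction matched unmatched′
        done′ : List Pair
        done′ = (i , m i) ∷ (m i , i) ∷ done
        symmetric′ : ∀ {j} → Matched done′ j → Matched done′ (m j)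
        symmetric′ (here refl)             = there (here refl)
        symmetric′ (there (here refl))     = here (sym (involutive i))
        symmetric′ (there (there matched)) = there (there (symmetric matched))
        covered′ : ∀ j → j ∈ todo ⊎ Matched done′ j
        covered′ j with covered j
        ... | inj₁ (here refl)  = inj₂ (here refl)
        ... | inj₁ (there j∈)   = inj₁ j∈
        ... | inj₂ matched      = inj₂ (there (there matched))

-- Chord matchings of orders 5 to 13

Toured : ∀ {n} → (Fin n → Fin n) → Set
Toured {n} m = (s : Vec (Fin n) 4) → Unique s → TourThrough (Linked m) s

AllObstructed : ∀ n → List (Vec (Fin n) 4) → Set
AllObstructed n ss = EveryMatching (λ done → Any (Obstructed (assoc done)) ss) (allFin n) []

allObstructed? : ∀ n (ss : List (Vec (Fin n) 4)) → Dec (AllObstructed n ss)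
allObstructed? n ss = everyMatching? _ (λ done → Any.any? (obstructed? (assoc done)) ss) (allFin n) []

¬sparse-toured : ∀ {n} (ss : List (Vec (Fin n) 4)) → All Unique ss → AllObstructed n ss →
  {m : Fin n → Fin n} → SparseMatching m → ¬ Toured m
¬sparse-toured {n} ss unique allObstructed sparse toured
  with done , agrees , obstructed ←
    matching-leaf _ sparse (allFin n) [] (λ ()) (λ j → inj₁ (∈-allFin j)) allObstructed
  with unique-s , obstructed-s ← All.lookupAny unique obstructed =
  -- `assoc done` and `m` agree only pointwise, so the tour is transported edge by edge.
  ¬obstructed (Any.lookup obstructed) (relabel id id (λ _ → refl) (λ _ → refl)
    (λ {i} {j} → subst (λ v → j ∈ next i ∷ prev i ∷ v ∷ []) (sym (agrees i)))
    (toured _ unique-s)) obstructed-s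

-- Found by computer: each sparse matching of order 12 is obstructed by one of them.
obstructions : List (Vec (Fin 12) 4)
obstructions = List.map (Vec.map (_mod 12))
  ((0 ∷ 4 ∷ 11 ∷ 5 ∷ []) ∷ (0 ∷ 5 ∷ 1 ∷ 6 ∷ []) ∷ (0 ∷ 5 ∷ 3 ∷ 9 ∷ []) ∷ [])

¬sparse-toured-12 : {m : Fin 12 → Fin 12} → SparseMatching m → ¬ Toured m
¬sparse-toured-12 = ¬sparse-toured obstructions
  (from-yes (All.all? (allPairs? λ i j → ¬? (i ≟ j)) obstructions)) (from-yes (allObstructed? 12 obstructions))

-- On a pentagon any two vertices are within two steps in one of the two directions, so every chord
-- would close a triangle.
spread-5 : ∀ {n} → n ≡ 5 → {i v : Fin n} → Spread i v → ¬ Spread v i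
spread-5 refl {i} {v} = from-yes (all? λ i → all? λ v → spread? {5} i v →-dec ¬? (spread? v i)) i v

-- On a hexagon only the antipode is more than two steps away in both directions.
spread-6 : ∀ {n} → n ≡ 6 → {i v : Fin n} → Spread i v → Spread v i → v ≡ next (next (next i))
spread-6 refl {i} {v} = from-yes
  (all? λ i → all? λ v → spread? {6} i v →-dec spread? v i →-dec (v ≟ next (next (next i)))) i v

hexagon-K₃₃ : ∀ {n} → n ≡ 6 → {m : Fin n → Fin n} → (∀ i → m i ≡ next (next (next i))) →
  Σ[ τ ∈ Fin n ↔ Fin 6 ] (∀ i j → Linked m i j ⇔ Graph._~_ K[ 3 , 3 ] (Inverse.to τ i) (Inverse.to τ j))
hexagon-K₃₃ refl {m} antipodal = mk↔ₛ′ to from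
    (from-yes (all? λ k → to (from k) ≟ k)) (from-yes (all? λ i → from (to i) ≟ i))
  , λ i j → mk⇔ (proj₁ (links i j) ∘ subst (λ k → j ∈ next i ∷ prev i ∷ k ∷ []) (antipodal i))
                (subst (λ k → j ∈ next i ∷ prev i ∷ k ∷ []) (sym (antipodal i)) ∘ proj₂ (links i j))
  where
  open Graph K[ 3 , 3 ] using (_~_; _~?_)
  to from : Fin 6 → Fin 6
  -- Parity is the bipartition: even positions fill the side 0, 1, 2 and odd positions the side 3,
  -- 4, 5.
  to   = lookup (0F ∷ 3F ∷ 1F ∷ 4F ∷ 2F ∷ 5F ∷ [])
  from = lookup (0F ∷ 2F ∷ 4F ∷ 1F ∷ 3F ∷ 5F ∷ [])
  linked? : ∀ i j → Dec (Linked (next ∘ next ∘ next) i j)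
  linked? i j = Any.any? (j ≟_) (next i ∷ prev i ∷ next (next (next i)) ∷ [])
  links : ∀ i j →
    (Linked (next ∘ next ∘ next) i j → to i ~ to j) × (to i ~ to j → Linked (next ∘ next ∘ next) i j)
  links = from-yes (all? λ i → all? λ j →
    (linked? i j →-dec (to i ~? to j)) ×-dec ((to i ~? to j) →-dec linked? i j))

-- With an empty list of sequences no leaf can hold, so the evaluation shows that this order has no
-- sparse matching at all; likewise for 8 to 11 and 13. Odd orders fail by parity. A cubic graph of
-- girth at least 5 has at least ten vertices, with equality only for the Petersen graph, which is
-- not hamiltonian.
¬sparse-toured-7 : {m : Fin 7 → Fin 7} → SparseMatching m → ¬ Toured m
¬sparse-toured-7 = ¬sparse-toured [] [] (from-yes (allObstructed? 7 []))

¬sparse-toured-8 : {m : Fin 8 → Fin 8} → SparseMatching m → ¬ Toured m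
¬sparse-toured-8 = ¬sparse-toured [] [] (from-yes (allObstructed? 8 []))

¬sparse-toured-9 : {m : Fin 9 → Fin 9} → SparseMatching m → ¬ Toured m
¬sparse-toured-9 = ¬sparse-toured [] [] (from-yes (allObstructed? 9 []))

¬sparse-toured-10 : {m : Fin 10 → Fin 10} → SparseMatching m → ¬ Toured m
¬sparse-toured-10 = ¬sparse-toured [] [] (from-yes (allObstructed? 10 []))

¬sparse-toured-11 : {m : Fin 11 → Fin 11} → SparseMatching m → ¬ Toured m
¬sparse-toured-11 = ¬sparse-toured [] [] (from-yes (allObstructed? 11 []))

¬sparse-toured-13 : {m : Fin 13 → Fin 13} → SparseMatching m → ¬ Toured m
¬sparse-toured-13 = ¬sparse-toured [] [] (from-yes (allObstructed? 13 []))

¬sparse-toured-7+ : ∀ (k : Fin 7) {n} → n ≡ 7 + toℕ k → {m : Fin n → Fin n} → SparseMatching m → ¬ Toured m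
¬sparse-toured-7+ 0F refl = ¬sparse-toured-7
¬sparse-toured-7+ 1F refl = ¬sparse-toured-8
¬sparse-toured-7+ 2F refl = ¬sparse-toured-9
¬sparse-toured-7+ 3F refl = ¬sparse-toured-10
¬sparse-toured-7+ 4F refl = ¬sparse-toured-11
¬sparse-toured-7+ 5F refl = ¬sparse-toured-12
¬sparse-toured-7+ 6F refl = ¬sparse-toured-13

-- Cubic graphs

module Neighbourhoods (G : Graph) (cubic : Regular 3 G) where
  open Graph G

  record Neighbours (v x y z : Vertex) : Set where
    field
      x≢y  : x ≢ y
      x≢z  : x ≢ z
      y≢z  : y ≢ z
      v~x  : v ~ x
      v~y  : v ~ y
      v~z  : v ~ z
      only : ∀ {u} → v ~ u → u ≡ x ⊎ u ≡ y ⊎ u ≡ z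

  open Neighbours

  swap₁₂ : ∀ {v x y z} → Neighbours v x y z → Neighbours v y x z
  swap₁₂ N = record
    { x≢y = ≢-sym (x≢y N) ; x≢z = y≢z N ; y≢z = x≢z N ; v~x = v~y N ; v~y = v~x N ; v~z = v~z N
    ; only = [ inj₂ ∘ inj₁ , [ inj₁ , inj₂ ∘ inj₂ ]′ ]′ ∘ only N }

  swap₂₃ : ∀ {v x y z} → Neighbours v x y z → Neighbours v x z y
  swap₂₃ N = record
    { x≢y = x≢z N ; x≢z = x≢y N ; y≢z = ≢-sym (y≢z N) ; v~x = v~x N ; v~y = v~z N ; v~z = v~y N
    ; only = [ inj₁ , [ inj₂ ∘ inj₂ , inj₂ ∘ inj₁ ]′ ]′ ∘ only N }

  neighbours : ∀ v → ∃[ x ] ∃[ y ] ∃[ z ] Neighbours v x y z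
  neighbours v = fromList _ (cubic v) (filter⁺ (v ~?_) (allFin⁺ order))
      (proj₂ ∘ ∈-filter⁻ (v ~?_) {xs = allFin order}) (λ v~u → ∈-filter⁺ (v ~?_) (∈-allFin _) v~u)
    where
    fromList : ∀ xs → length xs ≡ 3 → ListUnique.Unique xs →
      (∀ {u} → u ∈ xs → v ~ u) → (∀ {u} → v ~ u → u ∈ xs) →
      ∃[ x ] ∃[ y ] ∃[ z ] Neighbours v x y z
    fromList (x ∷ y ∷ z ∷ []) _ ((xy ∷ xz ∷ []) ∷ (yz ∷ []) ∷ _) sound complete = x , y , z , record
      { x≢y = xy ; x≢z = xz ; y≢z = yz
      ; v~x = sound (here refl) ; v~y = sound (there (here refl)) ; v~z = sound (there (there (here refl)))
      ; only = λ v~u → cases (complete v~u) }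
      where
      cases : ∀ {u} → u ∈ x ∷ y ∷ z ∷ [] → u ≡ x ⊎ u ≡ y ⊎ u ≡ z
      cases (here eq)                 = inj₁ eq
      cases (there (here eq))         = inj₂ (inj₁ eq)
      cases (there (there (here eq))) = inj₂ (inj₂ eq)

  third : ∀ {v x y} → v ~ x → v ~ y → x ≢ y → ∃[ z ] Neighbours v x y z
  third {v} vx vy x≢y with neighbours v
  ... | a , b , c , N with only N vx | only N vy
  ... | inj₁ refl        | inj₁ refl        = contradiction refl x≢y
  ... | inj₁ refl        | inj₂ (inj₁ refl) = c , N
  ... | inj₁ refl        | inj₂ (inj₂ refl) = b , swap₂₃ N
  ... | inj₂ (inj₁ refl) | inj₁ refl        = c , swap₁₂ N
  ... | inj₂ (inj₁ refl) | inj₂ (inj₁ refl) = contradiction refl x≢y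
  ... | inj₂ (inj₁ refl) | inj₂ (inj₂ refl) = a , swap₂₃ (swap₁₂ N)
  ... | inj₂ (inj₂ refl) | inj₁ refl        = b , swap₁₂ (swap₂₃ N)
  ... | inj₂ (inj₂ refl) | inj₂ (inj₁ refl) = a , swap₁₂ (swap₂₃ (swap₁₂ N))
  ... | inj₂ (inj₂ refl) | inj₂ (inj₂ refl) = contradiction refl x≢y

  exactly : ∀ {v x y z} → v ~ x → v ~ y → v ~ z → x ≢ y → x ≢ z → y ≢ z → Neighbours v x y z
  exactly vx vy vz x≢y x≢z y≢z with third vx vy x≢y
  ... | t , N with only N vz
  ... | inj₁ refl        = contradiction refl x≢z
  ... | inj₂ (inj₁ refl) = contradiction refl y≢z
  ... | inj₂ (inj₂ refl) = N

  ~⇒≢ : ∀ {u v} → u ~ v → u ≢ v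
  ~⇒≢ u~v refl = ~-irr refl u~v

  -- Edges used by a tour

  module TourProperties {v₀ v₁ v₂ v₃} (T : Tour _~_ v₀ v₁ v₂ v₃) where
    open Tour T

    Consecutive : Vertex → Vertex → Set
    Consecutive u v = ∃[ k ] k < order ×
      (walk k ≡ u × walk (suc k) ≡ v ⊎ walk k ≡ v × walk (suc k) ≡ u)

    consecutive-sym : ∀ {u v} → Consecutive u v → Consecutive v u
    consecutive-sym (k , k<n , inj₁ eqs) = k , k<n , inj₂ eqs
    consecutive-sym (k , k<n , inj₂ eqs) = k , k<n , inj₁ eqs

    -- The second alternative is the closing edge, between the last position and the first.
    consecutive-positions : ∀ {j k} → j < k → k < order → Consecutive (walk j) (walk k) →
      k ≡ suc j ⊎ (j ≡ 0 × suc k ≡ order)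
    consecutive-positions {j} {k} j<k k<n (i , i<n , eqs) = cases eqs
      where
      j<n = <-trans j<k k<n
      cases : walk i ≡ walk j × walk (suc i) ≡ walk k ⊎ walk i ≡ walk k × walk (suc i) ≡ walk j →
        k ≡ suc j ⊎ (j ≡ 0 × suc k ≡ order)
      cases (inj₁ (eq , eq′)) with refl ← injective i<n j<n eq =
        inj₁ (sym (injective (≤-<-trans j<k k<n) k<n eq′))
      cases (inj₂ (eq , eq′)) with refl ← injective i<n k<n eq with m≤n⇒m<n∨m≡n i<n
      ... | inj₁ 1+i<n = contradiction (injective 1+i<n j<n eq′) (>⇒≢ (<-trans j<k (n<1+n k)))
      ... | inj₂ 1+i≡n = inj₂ (sym (injective 0<n j<n
              (trans (sym closed) (trans (cong walk (sym 1+i≡n)) eq′))) , 1+i≡n)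

    consecutive-0 : ∀ {k} → 0 < k → k < order → Consecutive (walk 0) (walk k) → k ≡ 1 ⊎ suc k ≡ order
    consecutive-0 0<k k<n c with consecutive-positions 0<k k<n c
    ... | inj₁ eq       = inj₁ eq
    ... | inj₂ (_ , eq) = inj₂ eq

    ¬consecutive-self : ∀ {v} → ¬ Consecutive v v
    ¬consecutive-self (k , _ , inj₁ (eq , eq′)) = ~⇒≢ (step k) (trans eq (sym eq′))
    ¬consecutive-self (k , _ , inj₂ (eq , eq′)) = ~⇒≢ (step k) (trans eq (sym eq′))

    consecutive-inner : ∀ {j k} → 0 < j → suc j < order → k < order → Consecutive (walk j) (walk k) →
      k ≡ suc j ⊎ suc k ≡ j
    consecutive-inner {j} {k} 0<j 1+j<n k<n c with <-cmp j k
    consecutive-inner 0<j 1+j<n k<n c | tri< j<k _ _ with consecutive-positions j<k k<n c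
    ... | inj₁ eq         = inj₁ eq
    ... | inj₂ (refl , _) = contradiction refl (<⇒≢ 0<j)
    consecutive-inner 0<j 1+j<n k<n c | tri≈ _ refl _ = contradiction c ¬consecutive-self
    consecutive-inner 0<j 1+j<n k<n c | tri> _ _ k<j
      with consecutive-positions k<j (<-trans (n<1+n _) 1+j<n) (consecutive-sym c)
    ... | inj₁ eq       = inj₂ (sym eq)
    ... | inj₂ (_ , eq) = contradiction eq (<⇒≢ 1+j<n)

    before : ∀ {k} → k < order → ∃[ j ] j < order × walk (suc j) ≡ walk k
    before {suc k} k<n = k , <-trans (n<1+n k) k<n , refl
    before {zero}  0<n = ℕ.pred order , ≤-reflexive 1+pred , trans (cong walk 1+pred) closed
      where 1+pred = suc-pred order {{ℕ.>-nonZero 0<n}}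

    -- The predecessor and the successor of a vertex differ because the tour has more than two
    -- vertices. The four cases record whether `j` or `k` is the last position, where the walk wraps
    -- around.
    no-return : ∀ {j k} → j < order → k < order → walk (suc j) ≡ walk k → walk (suc k) ≢ walk j
    no-return {j} {k} j<n k<n eq eq′ with m≤n⇒m<n∨m≡n j<n | m≤n⇒m<n∨m≡n k<n
    ... | inj₁ 1+j<n | inj₁ 1+k<n with refl ← injective 1+j<n k<n eq =
      contradiction (injective 1+k<n j<n eq′) (>⇒≢ (<-trans (n<1+n j) (n<1+n (suc j))))
    ... | inj₁ 1+j<n | inj₂ 1+k≡n
      with refl ← injective 0<n j<n (trans (sym (trans (cong walk 1+k≡n) closed)) eq′)
         | refl ← injective 1+j<n k<n eq = contradiction 1+k≡n (<⇒≢ 2<n)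
    ... | inj₂ 1+j≡n | inj₁ 1+k<n
      with refl ← injective 0<n k<n (trans (sym (trans (cong walk 1+j≡n) closed)) eq)
         | refl ← injective 1+k<n j<n eq′ = contradiction 1+j≡n (<⇒≢ 2<n)
    ... | inj₂ 1+j≡n | inj₂ 1+k≡n
      with refl ← injective 0<n k<n (trans (sym (trans (cong walk 1+j≡n) closed)) eq) =
      contradiction 1+k≡n (<⇒≢ (<-trans (n<1+n 1) 2<n))

    -- By `no-return` the tour enters and leaves `v` along different edges, so avoiding one of the
    -- three forces the other two.
    two-consecutive : ∀ {v x y z} → Neighbours v x y z → ¬ Consecutive v x → Consecutive v y × Consecutive v z
    two-consecutive {v} N ¬vx with visits v
    ... | k , k<n , refl with before k<n
    ... | j , j<n , eq with only N (step k) | only N (subst (_~ walk j) eq (~-sym (step j)))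
    ... | inj₁ k₊      | _             = contradiction (k , k<n , inj₁ (refl , k₊)) ¬vx
    ... | inj₂ _         | inj₁ k₋     = contradiction (j , j<n , inj₂ (k₋ , eq)) ¬vx
    ... | inj₂ (inj₁ k₊) | inj₂ (inj₂ k₋) = (k , k<n , inj₁ (refl , k₊)) , (j , j<n , inj₂ (k₋ , eq))
    ... | inj₂ (inj₂ k₊) | inj₂ (inj₁ k₋) = (j , j<n , inj₂ (k₋ , eq)) , (k , k<n , inj₁ (refl , k₊))
    ... | inj₂ (inj₁ k₊) | inj₂ (inj₁ k₋) = contradiction (trans k₊ (sym k₋)) (no-return j<n k<n eq)
    ... | inj₂ (inj₂ k₊) | inj₂ (inj₂ k₋) = contradiction (trans k₊ (sym k₋)) (no-return j<n k<n eq)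

    -- On the tour, `v₁` separates the two on one side and `v₃` on the other.
    ¬consecutive₀₂ : ¬ Consecutive v₀ v₂
    ¬consecutive₀₂ c
      with consecutive-0 (<-trans 0<k₁ k₁<k₂) k₂<n (subst₂ Consecutive (sym at₀) (sym at₂) c)
    ... | inj₁ k₂≡1 = contradiction k₂≡1 (>⇒≢ (≤-<-trans 0<k₁ k₁<k₂))
    ... | inj₂ 1+k₂≡n = contradiction 1+k₂≡n (<⇒≢ (≤-<-trans k₂<k₃ k₃<n))

    -- Here `v₂` and `v₀` are the separating vertices.
    ¬consecutive₁₃ : ¬ Consecutive v₁ v₃
    ¬consecutive₁₃ c
      with consecutive-positions (<-trans k₁<k₂ k₂<k₃) k₃<n (subst₂ Consecutive (sym at₁) (sym at₃) c)
    ... | inj₁ k₃≡1+k₁    = contradiction k₃≡1+k₁ (>⇒≢ (≤-<-trans k₁<k₂ k₂<k₃))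
    ... | inj₂ (k₁≡0 , _) = contradiction k₁≡0 (>⇒≢ 0<k₁)

    adjacent₀ : ∀ {k} → k < order → Consecutive v₀ (walk k) → k ≡ 1 ⊎ suc k ≡ order
    adjacent₀ {zero}  _   c = contradiction (subst (λ x → Consecutive x (walk 0)) (sym at₀) c) ¬consecutive-self
    adjacent₀ {suc k} k<n c = consecutive-0 z<s k<n (subst (λ x → Consecutive x (walk (suc k))) (sym at₀) c)

    -- A tour neighbour of both `v₀` and `v₂` is all that lies between them on its side, and `v₁` or
    -- `v₃` lies there.
    between₀₂ : ∀ {c} → Consecutive c v₀ → Consecutive c v₂ → c ≡ v₁ ⊎ c ≡ v₃
    between₀₂ {c} c₀ c₂ with visits c
    ... | q , q<n , refl
      with adjacent₀ q<n (consecutive-sym c₀)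
         | consecutive-inner (<-trans 0<k₁ k₁<k₂) (≤-<-trans k₂<k₃ k₃<n) q<n
             (subst (λ x → Consecutive x (walk q)) (sym at₂) (consecutive-sym c₂))
    ... | inj₁ refl  | inj₁ 1≡1+k₂ = contradiction (ℕ.suc-injective (sym 1≡1+k₂)) (>⇒≢ (<-trans 0<k₁ k₁<k₂))
    ... | inj₁ refl  | inj₂ 2≡k₂   = inj₁ (trans (cong walk 1≡k₁) at₁)
      where 1≡k₁ = ≤-antisym 0<k₁ (≤-pred (≤-trans k₁<k₂ (≤-reflexive (sym 2≡k₂))))
    ... | inj₂ 1+q≡n | inj₁ refl   = inj₂ (trans (cong walk q≡k₃) at₃)
      where q≡k₃ = ≤-antisym k₂<k₃ (≤-pred (≤-trans k₃<n (≤-reflexive (sym 1+q≡n))))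
    ... | inj₂ 1+q≡n | inj₂ 1+q≡k₂ = contradiction (trans (sym 1+q≡k₂) 1+q≡n) (<⇒≢ k₂<n)

    -- The tour neighbours of `v₀` sit at positions 1 and `order − 1`. The latter is out of reach of
    -- `v₁`, since `v₂` and `v₃` come after it, so `x` and `y` would both sit at position 1.
    ¬common-neighbours₀₁ : ∀ {x y} → x ≢ y →
      Consecutive v₀ x → Consecutive v₀ y → Consecutive v₁ x → ¬ Consecutive v₁ y
    ¬common-neighbours₀₁ {x} {y} x≢y 0x 0y 1x 1y with visits x | visits y
    ... | q , q<n , refl | r , r<n , refl = cases (adjacent₀ q<n 0x) (adjacent₀ r<n 0y)
      where
      1+k₁<n = ≤-<-trans k₁<k₂ k₂<n
      2+k₁<n = ≤-<-trans (≤-<-trans k₁<k₂ k₂<k₃) k₃<n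
      notLast : ∀ {k} → k < order → Consecutive v₁ (walk k) → suc k ≢ order
      notLast {k} k<n c eq
        with consecutive-inner 0<k₁ 1+k₁<n k<n (subst (λ x → Consecutive x (walk k)) (sym at₁) c)
      ... | inj₁ refl   = contradiction eq (<⇒≢ 2+k₁<n)
      ... | inj₂ 1+k≡k₁ = contradiction (trans (sym 1+k≡k₁) eq) (<⇒≢ k₁<n)
      cases : q ≡ 1 ⊎ suc q ≡ order → r ≡ 1 ⊎ suc r ≡ order → ⊥
      cases (inj₁ refl) (inj₁ refl) = x≢y refl
      cases (inj₂ eq)   _           = notLast q<n 1x eq
      cases _           (inj₂ eq)   = notLast r<n 1y eq

  -- The traversal is rotated to begin at `p 0F`; subtracting `p 0F` from the increasing positions
  -- keeps them increasing and below the order.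
  tour : ∀ {v : Fin 4 → Vertex} (C : HamiltonianCycle G) → Encounters {G} C v →
    Tour _~_ (v 0F) (v 1F) (v 2F) (v 3F)
  tour {v} C (p , at-p , p-mono) = record
    { walk = λ k → at (shift k (p 0F))
    ; step = λ k → subst (λ i → at (shift k (p 0F)) ~ at i) (next-shift k (p 0F)) (adjacent _)
    ; closed = cong at (trans (shift-order (p 0F)) (sym (shift-0 (p 0F))))
    ; injective = λ j<n k<n eq → shift-injective (p 0F) j<n k<n (proj₁ bijective eq)
    ; visits = λ u → let (i , eq) = proj₂ bijective u in
        distance (p 0F) i , toℕ<n _ , trans (cong at (shift-distance (p 0F) i)) (eq refl)
    ; 0<k₁ = m<n⇒0<n∸m p₀<p₁
    ; k₁<k₂ = ∸-monoˡ-< p₁<p₂ (<⇒≤ p₀<p₁)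
    ; k₂<k₃ = ∸-monoˡ-< p₂<p₃ (<⇒≤ p₀<p₂)
    ; k₃<n = ≤-<-trans (m∸n≤m (toℕ (p 3F)) (toℕ (p 0F))) (toℕ<n (p 3F))
    ; at₀ = trans (cong at (shift-0 (p 0F))) (at-p 0F)
    ; at₁ = reaches p₀<p₁
    ; at₂ = reaches p₀<p₂
    ; at₃ = reaches (<-trans p₀<p₂ p₂<p₃)
    }
    where
    open HamiltonianCycle C
    p₀<p₁ : p 0F Fin.< p 1F
    p₀<p₁ = p-mono z<s
    p₁<p₂ : p 1F Fin.< p 2F
    p₁<p₂ = p-mono (s<s z<s)
    p₂<p₃ : p 2F Fin.< p 3F
    p₂<p₃ = p-mono (s<s (s<s z<s))
    p₀<p₂ : p 0F Fin.< p 2F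
    p₀<p₂ = <-trans p₀<p₁ p₁<p₂
    reaches : ∀ {i} → p 0F Fin.< p i → at (shift (toℕ (p i) ∸ toℕ (p 0F)) (p 0F)) ≡ v i
    reaches {i} p₀<pᵢ = trans (cong at (shift-toℕ _ (m+[n∸m]≡n (<⇒≤ p₀<pᵢ)))) (at-p i)

  -- Triangles, squares and small orders of 4-ordered cubic graphs

  module Ordered (ordered : OrderedHamiltonian 4 G) where

    tourThrough : (s : Vec Vertex 4) → Unique s → TourThrough _~_ s
    tourThrough s unique with C , encounters ← ordered (lookup s) (lookup-injective unique _ _) =
      tour C encounters

    -- Two vertices `d`, `e` outside the triangle exist by the bound on the order. A tour meeting
    -- `a`, `d`, `b`, `e` avoids the edge `a − b`, hence uses `a − c` and `b − c`, and `between₀₂`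
    -- makes `c` equal to `d` or `e`.
    triangle-free : 4 < order → ∀ {a b c} → a ~ b → b ~ c → ¬ a ~ c
    triangle-free 4<n {a} {b} {c} ab bc ac
      with d , d∉ ← fresh (a ∷ b ∷ c ∷ []) (<-trans (n<1+n 3) 4<n)
      with e , e∉ ← fresh (d ∷ a ∷ b ∷ c ∷ []) 4<n = [ d∉ ∘ c∈d , e∉ ∘ c∈e ]′ (between₀₂
          (consecutive-sym (proj₁ (two-consecutive (proj₂ (third ab ac (~⇒≢ bc))) ¬consecutive₀₂)))
          (consecutive-sym (proj₁ (two-consecutive (proj₂ (third (~-sym ab) bc (~⇒≢ ac)))
            (¬consecutive₀₂ ∘ consecutive-sym)))))
      where
      c∈d : c ≡ d → d ∈ a ∷ b ∷ c ∷ []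
      c∈d refl = there (there (here refl))
      c∈e : c ≡ e → e ∈ d ∷ a ∷ b ∷ c ∷ []
      c∈e refl = there (there (there (here refl)))
      T : Tour _~_ a d b e
      T = tourThrough (a ∷ d ∷ b ∷ e ∷ [])
        (((λ { refl → d∉ (here refl) }) ∷ ~⇒≢ ab ∷ (λ { refl → e∉ (there (here refl)) }) ∷ [])
        ∷ ((λ { refl → d∉ (there (here refl)) }) ∷ (λ { refl → e∉ (here refl) }) ∷ [])
        ∷ ((λ { refl → e∉ (there (there (here refl))) }) ∷ [])
        ∷ [] ∷ [])
      open TourProperties T

    -- If a′ ≢ c′, a tour meeting a, c, a′, c′ in this order avoids the edges a − a′ and c − c′,
    -- hence uses all four edges of the square a − b − c − d − a.
    square-third : 4 < order → ∀ {a c b d a′ c′} → a ≢ c → Neighbours a b d a′ → Neighbours c b d c′ → a′ ≡ c′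
    square-third 4<n {a} {c} {b} {d} {a′} {c′} a≢c Na Nc with a′ ≟ c′
    ... | yes a′≡c′ = a′≡c′
    ... | no  a′≢c′ = ⊥-elim (¬common-neighbours₀₁ (x≢y Na)
            (proj₁ a-bd) (proj₂ a-bd) (proj₁ c-bd) (proj₂ c-bd))
      where
      ¬a~c : ¬ a ~ c
      ¬a~c ac = triangle-free 4<n ac (v~x Nc) (v~x Na)
      T : Tour _~_ a c a′ c′
      T = tourThrough (a ∷ c ∷ a′ ∷ c′ ∷ [])
        ((a≢c ∷ ~⇒≢ (v~z Na) ∷ (λ { refl → ¬a~c (~-sym (v~z Nc)) }) ∷ [])
        ∷ ((λ { refl → ¬a~c (v~z Na) }) ∷ ~⇒≢ (v~z Nc) ∷ [])
        ∷ (a′≢c′ ∷ [])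
        ∷ [] ∷ [])
      open TourProperties T
      a-bd = two-consecutive (swap₁₂ (swap₂₃ Na)) ¬consecutive₀₂
      c-bd = two-consecutive (swap₁₂ (swap₂₃ Nc)) ¬consecutive₁₃

    module Connectivity (connected : Connected G) where

      -- The six vertices are closed under adjacency, so connectedness leaves no room for a seventh.
      K₃₃-order : ∀ {a c f x y z} → Neighbours a x y z → Neighbours c x y z → Neighbours f x y z →
        Neighbours x a c f → Neighbours y a c f → Neighbours z a c f → ¬ 6 < order
      K₃₃-order {a} {c} {f} {x} {y} {z} Na Nc Nf Nx Ny Nz 6<n with v , v∉ ← fresh _ 6<n =
        v∉ (reach (proj₂ connected a v) (here refl))
        where
        block : List Vertex
        block = a ∷ c ∷ f ∷ x ∷ y ∷ z ∷ []
        among : ∀ {p q r u : Vertex} → u ≡ p ⊎ u ≡ q ⊎ u ≡ r → u ∈ p ∷ q ∷ r ∷ []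
        among (inj₁ eq)        = here eq
        among (inj₂ (inj₁ eq)) = there (here eq)
        among (inj₂ (inj₂ eq)) = there (there (here eq))
        closed : ∀ {u w} → u ~ w → u ∈ block → w ∈ block
        closed u~w (here refl)                                         = ∈-++⁺ʳ (a ∷ c ∷ f ∷ []) (among (only Na u~w))
        closed u~w (there (here refl))                                 = ∈-++⁺ʳ (a ∷ c ∷ f ∷ []) (among (only Nc u~w))
        closed u~w (there (there (here refl)))                         = ∈-++⁺ʳ (a ∷ c ∷ f ∷ []) (among (only Nf u~w))
        closed u~w (there (there (there (here refl))))                 = ∈-++⁺ˡ (among (only Nx u~w))
        closed u~w (there (there (there (there (here refl)))))         = ∈-++⁺ˡ (among (only Ny u~w))
        closed u~w (there (there (there (there (there (here refl)))))) = ∈-++⁺ˡ (among (only Nz u~w))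
        reach : ∀ {u w} → Star _~_ u w → u ∈ block → w ∈ block
        reach ε            u∈ = u∈
        reach (u~t ◅ path) u∈ = reach path (closed u~t u∈)

      -- Repeated use of `square-third`: `a` and `c` share their third neighbour `z`, and then `x`,
      -- `y`, `z` share their third neighbour `f`. This yields a K₃,₃ with sides `a`, `c`, `f` and
      -- `x`, `y`, `z`.
      square-free : 6 < order → ∀ {a c x y} → a ≢ c → x ≢ y → a ~ x → a ~ y → c ~ x → ¬ c ~ y
      square-free 6<n a≢c x≢y ax ay cx cy
        with 4<n ← <-trans (n<1+n 4) (<-trans (n<1+n 5) 6<n)
        with z , Na ← third ax ay x≢y
           | z′ , Nc ← third cx cy x≢y
        with refl ← square-third 4<n a≢c Na Nc
        with f , Nx ← third (~-sym ax) (~-sym cx) a≢c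
           | f′ , Ny ← third (~-sym ay) (~-sym cy) a≢c
           | f″ , Nz ← third (~-sym (v~z Na)) (~-sym (v~z Nc)) a≢c
        with refl ← square-third 4<n x≢y Nx Ny
           | refl ← square-third 4<n (x≢z Na) Nx Nz =
        K₃₃-order Na Nc
          (exactly (~-sym (v~z Nx)) (~-sym (v~z Ny)) (~-sym (v~z Nz)) x≢y (x≢z Na) (y≢z Na))
          Nx Ny Nz 6<n

      -- A vertex with its three neighbours. It bounds the order from below and is the sequence to
      -- which `ordered` is applied to obtain a first hamiltonian cycle.
      claw : Σ[ s ∈ Vec Vertex 4 ] Unique s
      claw with x , y , z , N ← neighbours (fromℕ< (ℕ.>-nonZero⁻¹ order {{proj₁ connected}})) = _ ,
        (~⇒≢ (v~x N) ∷ ~⇒≢ (v~y N) ∷ ~⇒≢ (v~z N) ∷ [])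
        ∷ (x≢y N ∷ x≢z N ∷ []) ∷ (y≢z N ∷ []) ∷ [] ∷ []

      4≤order : 4 ≤ order
      4≤order = injective⇒≤ (lookup-injective (proj₂ claw) _ _)

      -- A vertex not adjacent to `u` would give, together with `u` and its three neighbours, five
      -- distinct vertices.
      order≡4⇒≅K₄ : order ≡ 4 → G ≅ K 4
      order≡4⇒≅K₄ eq = ≅K eq
        where
        complete : ∀ {u v} → u ≢ v → u ~ v
        complete {u} {v} u≢v with u ~? v
        ... | yes u~v = u~v
        ... | no ¬u~v with x , y , z , N ← neighbours u = contradiction (≤-reflexive eq)
          (<⇒≱ (injective⇒≤ (lookup-injective (
            (≢-sym u≢v ∷ (λ { refl → ¬u~v (v~x N) }) ∷ (λ { refl → ¬u~v (v~y N) }) ∷ (λ { refl → ¬u~v (v~z N) }) ∷ [])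
            ∷ (~⇒≢ (v~x N) ∷ ~⇒≢ (v~y N) ∷ ~⇒≢ (v~z N) ∷ [])
            ∷ (x≢y N ∷ x≢z N ∷ []) ∷ (y≢z N ∷ []) ∷ [] ∷ []) _ _)))
        -- `order` does not unify with the literal 4; with a variable `n` the equation can be
        -- matched.
        ≅K : ∀ {n} → order ≡ n → G ≅ K n
        ≅K refl = ↔-id _ , λ u v → mk⇔ ~⇒≢ complete

      -- The graph as a hamiltonian cycle with chords

      module Labelling (C : HamiltonianCycle G) where
        open HamiltonianCycle C

        label : Vertex → Fin order
        label u = proj₁ (proj₂ bijective u)

        at-label : ∀ u → at (label u) ≡ u
        at-label u = proj₂ (proj₂ bijective u) refl

        at-injective : ∀ {i j} → at i ≡ at j → i ≡ j
        at-injective = proj₁ bijective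

        label-at : ∀ i → label (at i) ≡ i
        label-at i = at-injective (at-label (at i))

        at-chord : ∀ i → ∃[ j ] Neighbours (at i) (at (next i)) (at (prev i)) (at j)
        at-chord i with z , N ← third (adjacent i)
            (~-sym (subst (λ j → at (prev i) ~ at j) (next-prev i) (adjacent (prev i))))
            -- `next i` and `prev i` differ because the cycle has length at least three.
            (λ eq → next²≢ length≥3 i (trans (cong next (at-injective eq)) (next-prev i)))
          = label z , subst (Neighbours _ _ _) (sym (at-label z)) N

        module Chords (chord : Fin order → Fin order)
          (at-neighbours : ∀ i → Neighbours (at i) (at (next i)) (at (prev i)) (at (chord i))) where

          at~chord : ∀ i → at i ~ at (chord i)
          at~chord i = v~z (at-neighbours i)

          ~⇒linked : ∀ {i j} → at i ~ at j → Linked chord i j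
          ~⇒linked {i} i~j with only (at-neighbours i) i~j
          ... | inj₁ eq        = here (at-injective eq)
          ... | inj₂ (inj₁ eq) = there (here (at-injective eq))
          ... | inj₂ (inj₂ eq) = there (there (here (at-injective eq)))

          linked⇒~ : ∀ {i j} → Linked chord i j → at i ~ at j
          linked⇒~ {i} (here refl)                 = v~x (at-neighbours i)
          linked⇒~ {i} (there (here refl))         = v~y (at-neighbours i)
          linked⇒~ {i} (there (there (here refl))) = v~z (at-neighbours i)

          -- If `i` followed or preceded `chord i` on the cycle, then `chord i` would be `prev i` or
          -- `next i`, which the third neighbour is not.
          chord-involutive : ∀ i → chord (chord i) ≡ i
          chord-involutive i with ~⇒linked (~-sym (at~chord i))
          ... | here i≡next = contradiction
                  (cong at (trans (cong prev i≡next) (prev-next (chord i)))) (y≢z (at-neighbours i))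
          ... | there (here i≡prev) = contradiction
                  (cong at (trans (cong next i≡prev) (next-prev (chord i)))) (x≢z (at-neighbours i))
          ... | there (there (here i≡chord)) = sym i≡chord

          chord-spread : 4 < order → ∀ i → Spread i (chord i)
          chord-spread 4<n i =
              (λ eq → ~⇒≢ (at~chord i) (cong at (sym eq)))
            , (λ eq → x≢z (at-neighbours i) (cong at (sym eq)))
            , (λ eq → triangle-free 4<n (adjacent i) (adjacent (next i))
                (subst (λ j → at i ~ at j) eq (at~chord i)))

          chord-spread′ : 4 < order → ∀ i → Spread (chord i) i
          chord-spread′ 4<n i = subst (Spread (chord i)) (chord-involutive i) (chord-spread 4<n (chord i))

          chord-sparse : 6 < order → SparseMatching chord
          chord-sparse 6<n = record
            { involutive = chord-involutive
            ; remote = λ i → chord-spread 4<n i , λ eq → square-free 6<n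
                (λ eq′ → next²≢ length≥3 i (sym (at-injective eq′)))
                (λ eq′ → next²≢ length≥3 (next i) (sym (at-injective eq′)))
                (adjacent i) (subst (λ j → at i ~ at j) eq (at~chord i))
                (~-sym (adjacent (next i))) (adjacent (next (next i)))
            ; skew = skew
            }
            where
            4<n = <-trans (n<1+n 4) (<-trans (n<1+n 5) 6<n)
            -- The square in question is `i`, `next i`, `chord (next i)`, `chord i`; this separates
            -- the ends of one diagonal. If they agreed, applying `chord` would give
            -- `chord i ≡ next i`.
            apart : ∀ i → at i ≢ at (chord (next i))
            apart i eq = x≢z (at-neighbours i)
              (cong at (trans (sym (chord-involutive (next i))) (cong chord (sym (at-injective eq)))))
            skew : ∀ i j → Skew (i , chord i) (j , chord j)
            skew i _ refl =
                (λ eq → square-free 6<n (apart i) (x≢z (at-neighbours i)) (adjacent i) (at~chord i)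
                  (~-sym (at~chord (next i))) (subst (λ j → at j ~ at (chord i)) eq (~-sym (adjacent (chord i)))))
              , (λ eq → square-free 6<n (apart i) (x≢z (at-neighbours i)) (adjacent i) (at~chord i)
                  (~-sym (at~chord (next i)))
                  (subst (λ j → at (chord (next i)) ~ at j) eq (adjacent (chord (next i)))))

          chord-toured : Toured chord
          -- Splitting the vector lets `lookup` compute on `Vec.map at s`.
          chord-toured s@(_ ∷ _ ∷ _ ∷ _ ∷ []) unique = relabel label at at-label label-at
            (λ {u} {v} u~v → ~⇒linked (subst₂ _~_ (sym (at-label u)) (sym (at-label v)) u~v))
            (tourThrough (Vec.map at s) (map⁺ at-injective unique))

          ≅-via : ∀ {H} (τ : Fin order ↔ Graph.Vertex H) →
            (∀ i j → Linked chord i j ⇔ Graph._~_ H (Inverse.to τ i) (Inverse.to τ j)) → G ≅ H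
          ≅-via τ links =
              mk↔ₛ′ (Inverse.to τ ∘ label) (at ∘ Inverse.from τ)
                (λ k → trans (cong (Inverse.to τ) (label-at _)) (Inverse.strictlyInverseˡ τ k))
                (λ u → trans (cong at (Inverse.strictlyInverseʳ τ (label u))) (at-label u))
            , λ u v → mk⇔
                (λ u~v → Equivalence.to (links _ _)
                  (~⇒linked (subst₂ _~_ (sym (at-label u)) (sym (at-label v)) u~v)))
                (λ l → subst₂ _~_ (at-label u) (at-label v) (linked⇒~ (Equivalence.from (links _ _) l)))

          order≡6⇒≅K₃₃ : order ≡ 6 → G ≅ K[ 3 , 3 ]
          order≡6⇒≅K₃₃ eq = ≅-via {K[ 3 , 3 ]} (proj₁ hexagon) (proj₂ hexagon)
            where
            4<n = ≤-trans (n≤1+n 5) (≤-reflexive (sym eq))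
            hexagon = hexagon-K₃₃ eq λ i → spread-6 eq (chord-spread 4<n i) (chord-spread′ 4<n i)

      lowerBound : ¬ (G ≅ K 4) → ¬ (G ≅ K[ 3 , 3 ]) → 14 ≤ order
      lowerBound ≇K₄ ≇K₃₃ = ≮⇒≥ λ n<14 → ¬sparse-toured-7+
          -- The index is `order ∸ 7`, because the case list starts at order 7.
          (fromℕ< (∸-monoˡ-< n<14 6<n))
          (trans (sym (m+[n∸m]≡n 6<n)) (cong (7 +_) (sym (toℕ-fromℕ< _))))
          (chord-sparse 6<n) chord-toured
        where
        open Labelling (proj₁ (ordered (lookup (proj₁ claw)) (lookup-injective (proj₂ claw) _ _)))
        open Chords (proj₁ ∘ at-chord) (proj₂ ∘ at-chord)
        4<n : 4 < order
        4<n = ≤∧≢⇒< 4≤order (λ eq → ≇K₄ (order≡4⇒≅K₄ (sym eq)))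
        5<n : 5 < order
        -- A chord at any position gives the contradiction; the first vertex of the claw supplies a
        -- position.
        5<n = ≤∧≢⇒< 4<n (λ eq → spread-5 (sym eq)
          (chord-spread 4<n (label (lookup (proj₁ claw) 0F))) (chord-spread′ 4<n _))
        6<n : 6 < order
        6<n = ≤∧≢⇒< 5<n (λ eq → ≇K₃₃ (order≡6⇒≅K₃₃ (sym eq)))


-- The Heawood graph

module HeawoodTours where
  open Graph Heawood using (_~_; _~?_; degree)

  connected : Connected Heawood
  connected = _ , λ u v → Star.reverse (Graph.~-sym Heawood) (from-0 u) ◅◅ from-0 v
    where
    forward : ∀ i → inject₁ i ~ suc i
    forward = from-yes (all? λ i → inject₁ i ~? suc i)
    from-0 : ∀ v → Star _~_ 0F v
    from-0 = <-weakInduction (Star _~_ 0F) ε λ i path → path ◅◅ (forward i ◅ ε)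

  cubic : Regular 3 Heawood
  cubic = from-yes (all? λ v → degree v ℕ.≟ 3)

  -- Enumeration of the hamiltonian cycles

  paths : ∀ k → List (Vec (Fin 14) (suc k))
  paths zero    = (0F ∷ []) ∷ []
  paths (suc k) = concatMap (λ p → List.map (_∷ p) (filter (extension? p) (allFin 14))) (paths k)
    where
    extension? : (p : Vec (Fin 14) (suc k)) → Decidable (λ v → (head p ~ v) × ¬ VecAny.Any (v ≡_) p)
    extension? p v = (head p ~? v) ×-dec ¬? (VecAny.any? (v ≟_) p)

  position : Vec (Fin 14) 14 → Fin 14 → Fin 14
  position p v with VecAny.any? (v ≟_) p
  ... | yes v∈p = VecAny.index v∈p
  -- The default for vertices off the path; that the table inverts a complete path is certified by
  -- `Hamiltonian`.
  ... | no  _   = 0F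

  -- A vertex sequence together with the table of the positions of the vertices in it.
  Traversal : Set
  Traversal = Vec (Fin 14) 14 × Vec (Fin 14) 14

  -- Paths grow at the head, so each of these traversals ends at 0.
  traversals : List Traversal
  traversals = List.map (λ p → p , tabulate (position p)) (filter (λ p → head p ~? 0F) (paths 13))

  Hamiltonian : Traversal → Set
  Hamiltonian (p , q) =
    (∀ i → lookup q (lookup p i) ≡ i) × (∀ v → lookup p (lookup q v) ≡ v) ×
    (∀ i → lookup p i ~ lookup p (next i))

  hamiltonian? : Decidable Hamiltonian
  hamiltonian? (p , q) =
    all? (λ i → lookup q (lookup p i) ≟ i) ×-dec all? (λ v → lookup p (lookup q v) ≟ v) ×-dec
    all? (λ i → lookup p i ~? lookup p (next i))

  -- The enumeration is certified by its output: every entry is checked directly, in place of a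
  -- correctness proof of `paths`.
  traversals-hamiltonian : All Hamiltonian traversals
  traversals-hamiltonian = from-yes (All.all? hamiltonian? traversals)

  InOrder : (a b c d : Fin 14) → Traversal → Set
  InOrder a b c d (_ , q) =
    (lookup q a Fin.< lookup q b) × (lookup q b Fin.< lookup q c) × (lookup q c Fin.< lookup q d)

  inOrder? : ∀ a b c d → Decidable (InOrder a b c d)
  inOrder? a b c d (_ , q) =
    (lookup q a <? lookup q b) ×-dec (lookup q b <? lookup q c) ×-dec (lookup q c <? lookup q d)

  -- The inequalities are interleaved with the quantifiers so that deciding this proposition drops
  -- coinciding vertices early.
  OrdersAll : List Traversal → Set
  OrdersAll ts = ∀ a → a ≢ 0F → ∀ b → b ≢ 0F → a ≢ b → ∀ c → c ≢ 0F → a ≢ c → b ≢ c →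
    Any (InOrder a b c 0F) ts

  ordersAll? : Decidable OrdersAll
  ordersAll? ts = all? λ a → ¬? (a ≟ 0F) →-dec all? λ b → ¬? (b ≟ 0F) →-dec ¬? (a ≟ b) →-dec
    all? λ c → ¬? (c ≟ 0F) →-dec ¬? (a ≟ c) →-dec ¬? (b ≟ c) →-dec Any.any? (inOrder? a b c 0F) ts

  traversals-orderAll : OrdersAll traversals
  traversals-orderAll = from-yes (ordersAll? traversals)

  -- The automorphism x ↦ a + x or x ↦ a − x, for a even or odd; it sends 0 to a.
  turn unturn : Fin 14 → Fin 14 → Fin 14
  turn a x with 2 ∣? toℕ a
  ... | yes _ = shift (toℕ x) a
  ... | no  _ = shift (14 ∸ toℕ x) a
  unturn a y with 2 ∣? toℕ a
  ... | yes _ = shift (14 ∸ toℕ a) y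
  ... | no  _ = shift (14 ∸ toℕ y) a

  turn-unturn : ∀ a y → turn a (unturn a y) ≡ y
  turn-unturn = from-yes (all? λ a → all? λ y → turn a (unturn a y) ≟ y)

  unturn-turn : ∀ a x → unturn a (turn a x) ≡ x
  unturn-turn = from-yes (all? λ a → all? λ x → unturn a (turn a x) ≟ x)

  unturn-self : ∀ a → unturn a a ≡ 0F
  unturn-self = from-yes (all? λ a → unturn a a ≟ 0F)

  turn-~ : ∀ a x y → x ~ y → turn a x ~ turn a y
  turn-~ = from-yes (all? λ a → all? λ x → all? λ y → (x ~? y) →-dec (turn a x ~? turn a y))

  -- Undoing the turn by `v 3F` moves the last vertex to 0; a listed traversal meets the moved
  -- sequence in order, and turning it back gives the required cycle. With `ts` a variable, the
  -- argument involves no evaluation of the enumeration.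
  ordered-by : ∀ ts → All Hamiltonian ts → OrdersAll ts → OrderedHamiltonian 4 Heawood
  ordered-by ts hamiltonian ordersAll v v-injective =
    encounter (Any.lookup inOrder) (All.lookupAny hamiltonian inOrder)
    where
    a = v 3F
    w : Fin 4 → Fin 14
    w i = unturn a (v i)
    w-injective : ∀ {i j} → w i ≡ w j → i ≡ j
    w-injective eq = v-injective (trans (sym (turn-unturn a _)) (trans (cong (turn a) eq) (turn-unturn a _)))
    w≢0 : ∀ {i} → i ≢ 3F → w i ≢ 0F
    w≢0 i≢3 eq = i≢3 (w-injective (trans eq (sym (unturn-self a))))
    distinct : ∀ {i j} → i ≢ j → w i ≢ w j
    distinct i≢j = i≢j ∘ w-injective
    inOrder = ordersAll (w 0F) (w≢0 λ ()) (w 1F) (w≢0 λ ()) (distinct λ ())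
      (w 2F) (w≢0 λ ()) (distinct λ ()) (distinct λ ())
    encounter : ∀ t → Hamiltonian t × InOrder (w 0F) (w 1F) (w 2F) 0F t →
      ∃[ C ] Encounters {Heawood} C v
    encounter (p , q) ((qp , pq , adjacent) , 0<1 , 1<2 , 2<3) = record
        { length≥3  = s≤s (s≤s (s≤s z≤n))
        ; at        = at
        ; bijective = (λ eq → trans (sym (position-at _)) (trans (cong positionOf eq) (position-at _)))
                    , (λ y → positionOf y , λ { refl → at-position y })
        ; adjacent  = λ i → turn-~ a _ _ (adjacent i)
        } , positionOf ∘ v , (λ i → at-position (v i)) , increasing _ _
      where
      at positionOf : Fin 14 → Fin 14
      at i = turn a (lookup p i)
      positionOf y = lookup q (unturn a y)
      position-at : ∀ i → positionOf (at i) ≡ i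
      position-at i = trans (cong (lookup q) (unturn-turn a _)) (qp i)
      at-position : ∀ y → at (positionOf y) ≡ y
      at-position y = trans (cong (turn a) (pq _)) (turn-unturn a y)
      2<3′ : positionOf (v 2F) Fin.< positionOf (v 3F)
      2<3′ = subst (λ x → positionOf (v 2F) Fin.< lookup q x) (sym (unturn-self a)) 2<3
      increasing : ∀ i j → i Fin.< j → positionOf (v i) Fin.< positionOf (v j)
      increasing 0F 1F _ = 0<1
      increasing 0F 2F _ = ℕ.<-trans 0<1 1<2
      increasing 0F 3F _ = ℕ.<-trans 0<1 (ℕ.<-trans 1<2 2<3′)
      increasing 1F 2F _ = 1<2
      increasing 1F 3F _ = ℕ.<-trans 1<2 2<3′
      increasing 2F 3F _ = 2<3′
      increasing 1F 1F (s≤s ())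
      increasing 2F 1F (s≤s ())
      increasing 2F 2F (s≤s (s≤s ()))
      increasing 3F 1F (s≤s ())
      increasing 3F 2F (s≤s (s≤s ()))
      increasing 3F 3F (s≤s (s≤s (s≤s ())))

  ordered : OrderedHamiltonian 4 Heawood
  ordered = ordered-by traversals traversals-hamiltonian traversals-orderAll

≅⇒order≡ : ∀ {G H} → G ≅ H → Graph.order G ≡ Graph.order H
≅⇒order≡ (f , _) = ↔⇒≡ f

theorem3p4 :
    ((G : Graph) → Connected G → Regular 3 G → OrderedHamiltonian 4 G →
      ¬ (G ≅ K 4) → ¬ (G ≅ K[ 3 , 3 ]) → 14 ≤ Graph.order G)
    × (Graph.order Heawood ≡ 14 × Connected Heawood × Regular 3 Heawood
      × OrderedHamiltonian 4 Heawood
      × ¬ (Heawood ≅ K 4) × ¬ (Heawood ≅ K[ 3 , 3 ]))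
theorem3p4 =
    (λ G connected cubic ordered →
      Neighbourhoods.Ordered.Connectivity.lowerBound G cubic ordered connected)
  , refl , connected , cubic , ordered
  , (λ iso → contradiction (≅⇒order≡ {Heawood} {K 4} iso) λ ())
  , (λ iso → contradiction (≅⇒order≡ {Heawood} {K[ 3 , 3 ]} iso) λ ())
  where open HeawoodTours
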